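{- There is a single-pass streaming algorithm that for any integers $q, t \geq 2$, and any given $n$-vertex graph $G$ in a random order stream, with exponentially high probability (over the randomness of the stream), distinguishes between the cases $\chi(G) \leq q$ and $\chi(G) > q^t$ in $\widetilde{O}(n^{1+1/t})$ space.
   Context: $\chi(G)$ denotes the chromatic number. "Distinguishes between $\chi(G)\le q$ and $\chi(G)>q^t$" means: if $\chi(G)\leq q$ the algorithm answers "small", if $\chi(G)>q^t$ it answers "large" (no requirement otherwise). Random order streaming model: the vertex set $[n]$ is known in advance, the graph $G$ is chosen arbitrarily (adversarially), and its edges are presented to the algorithm in a uniformly random order, in a single pass. Space is measured in bits; there is no restriction on computation time (including time used at the end of or during the stream). $\widetilde{O}(\cdot)$ hides $\mathrm{poly}(\log n)$ factors. "Exponentially high probability" means probability at least $1-2^{ -\Omega(n)}$. -}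

module Defs where

open import Data.Bool.Base using (Bool)
open import Data.Fin.Base using (Fin)
open import Data.Fin.Properties using (any?; all?; _≟_) renaming (_<?_ to _<ᶠ?_)
open import Data.Integer.Base using (+_)
open import Data.List.Base
  using (List; []; _∷_; [_]; map; concatMap; filter; length; foldl; allFin; cartesianProduct)
open import Data.List.Properties using (length-++; length-map; length-tabulate)
open import Data.Nat.Base
  using (ℕ; zero; suc; _+_; _*_; _^_; _!; _≤_; _>_; z≤n; s≤s; NonZero)
open import Data.Nat.Logarithm using (⌈log₂_⌉)
open import Data.Nat.Properties using (_≤?_; _>?_; _!≢0; m^n≢0)
open import Data.Product.Base using (∃; ∃-syntax; Σ-syntax; _×_; _,_; proj₁; proj₂)
open import Data.Rational.Base using (ℚ; _/_)
open import Data.Vec.Base using (Vec; []; _∷_; lookup; tabulate; removeAt; fromList)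
open import Data.Vec.Properties using (lookup∘tabulate)
open import Function.Base using (_∘_; id)
open import Level using (0ℓ)
open import Relation.Binary.Core using (Rel)
import Relation.Binary.Definitions as B
open import Relation.Binary.PropositionalEquality
  using (_≡_; _≢_; refl; sym; trans; cong; cong₂; subst; subst₂)
open import Relation.Nullary.Decidable
  using (Dec; yes; no; map′; _×-dec_; _→-dec_; ¬?)
open import Relation.Nullary.Negation using (contradiction)
open import Relation.Unary using (Pred; Decidable)

record Graph (n : ℕ) : Set₁ where
  field
    Adj    : Rel (Fin n) 0ℓ
    Adj?   : B.Decidable Adj
    symm   : B.Symmetric Adj
    irrefl : B.Irreflexive _≡_ Adj

open Graph public

Edge : ℕ → Set
Edge n = Fin n × Fin n

-- Each undirected edge occurs exactly once, as the pair (u , v) with u < v.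
edges : ∀ {n} → Graph n → List (Edge n)
edges {n} G =
  filter (λ e → (proj₁ e <ᶠ? proj₂ e) ×-dec Adj? G (proj₁ e) (proj₂ e))
         (cartesianProduct (allFin n) (allFin n))

IsProper : ∀ {n k} → Graph n → (Fin n → Fin k) → Set
IsProper G c = ∀ u v → Adj G u v → c u ≢ c v

Colourable : ∀ {n} → Graph n → ℕ → Set
Colourable {n} G k = Σ[ c ∈ (Fin n → Fin k) ] IsProper G c

isProper? : ∀ {n k} (G : Graph n) (c : Fin n → Fin k) → Dec (IsProper G c)
isProper? G c = all? λ u → all? λ v → Adj? G u v →-dec ¬? (c u ≟ c v)

anyVec? : ∀ {k} n {P : Pred (Vec (Fin k) n) 0ℓ} → Decidable P → Dec (∃ P)
anyVec? zero    P? = map′ ([] ,_) (λ { ([] , p) → p }) (P? [])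
anyVec? (suc n) P? =
  map′ (λ { (x , v , p) → x ∷ v , p }) (λ { (x ∷ v , p) → x , v , p })
       (any? λ x → anyVec? n λ v → P? (x ∷ v))

colourable? : ∀ {n} (G : Graph n) → Decidable (Colourable G)
colourable? {n} G k =
  map′ (λ { (v , p) → lookup v , p })
       (λ { (c , p) → tabulate c , λ u v e →
            subst₂ _≢_ (sym (lookup∘tabulate c u)) (sym (lookup∘tabulate c v)) (p u v e) })
       (anyVec? n λ v → isProper? G (lookup v))

n-colourable : ∀ {n} (G : Graph n) → Colourable G n
n-colourable G = id , λ u v e u≡v → irrefl G u≡v e

least : ∀ {P : Pred ℕ 0ℓ} → Decidable P → ∀ m → P m →
        ∃[ k ] (P k × (∀ j → P j → k ≤ j))
least P? zero    p = zero , p , λ _ _ → z≤n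
least P? (suc m) p with P? zero
... | yes p₀ = zero , p₀ , λ _ _ → z≤n
... | no ¬p₀ with least (P? ∘ suc) m p
...   | k , pk , min = suc k , pk , λ where
          zero    p₀ → contradiction p₀ ¬p₀
          (suc j) pj → s≤s (min j pj)

χ-spec : ∀ {n} (G : Graph n) →
         ∃[ k ] (Colourable G k × (∀ j → Colourable G j → k ≤ j))
χ-spec {n} G = least (colourable? G) n (n-colourable G)

χ : ∀ {n} → Graph n → ℕ
χ G = proj₁ (χ-spec G)

χ-colourable : ∀ {n} (G : Graph n) → Colourable G (χ G)
χ-colourable G = proj₁ (proj₂ (χ-spec G))

χ-minimal : ∀ {n} (G : Graph n) k → Colourable G k → χ G ≤ k
χ-minimal G = proj₂ (proj₂ (χ-spec G))

data Answer : Set where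
  small large : Answer

_≟ᴬ_ : B.DecidableEquality Answer
small ≟ᴬ small = yes refl
small ≟ᴬ large = no λ ()
large ≟ᴬ small = no λ ()
large ≟ᴬ large = yes refl

-- A single-pass deterministic algorithm on streams of edges over the vertex
-- set Fin n.  Everything remembered between two edges (including, if needed,
-- a counter of edges seen so far) is a string of `space` bits.  The length of
-- the stream is not given in advance.  The transition and output functions
-- are unrestricted, since computation time is.
record StreamingAlgorithm (n : ℕ) : Set where
  field
    space  : ℕ
    init   : Vec Bool space
    step   : Vec Bool space → Edge n → Vec Bool space
    output : Vec Bool space → Answer

  run : List (Edge n) → Answer
  run stream = output (foldl step init stream)

open StreamingAlgorithm public

Distinguishes : (q t chromatic : ℕ) → Answer → Set
Distinguishes q t x a = (x ≤ q → a ≡ small) × (x > q ^ t → a ≡ large)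

distinguishes? : ∀ q t x → Decidable (Distinguishes q t x)
distinguishes? q t x a =
  ((x ≤? q) →-dec (a ≟ᴬ small)) ×-dec ((x >? q ^ t) →-dec (a ≟ᴬ large))

-- All m ! orderings: choose the first element, then order the remaining ones.
orderings : ∀ {A : Set} {m} → Vec A m → List (List A)
orderings {m = zero}  _  = [ [] ]
orderings {m = suc m} xs =
  concatMap (λ i → map (lookup xs i ∷_) (orderings (removeAt xs i))) (allFin (suc m))

length-concatMap-const : ∀ {A B : Set} {c} (f : A → List B) → (∀ x → length (f x) ≡ c) →
                         ∀ xs → length (concatMap f xs) ≡ length xs * c
length-concatMap-const f eq []       = refl
length-concatMap-const f eq (x ∷ xs) =
  trans (length-++ (f x)) (cong₂ _+_ (eq x) (length-concatMap-const f eq xs))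

length-orderings : ∀ {A : Set} {m} (xs : Vec A m) → length (orderings xs) ≡ m !
length-orderings {m = zero}  xs = refl
length-orderings {m = suc m} xs =
  trans (length-concatMap-const
           (λ i → map (lookup xs i ∷_) (orderings (removeAt xs i)))
           (λ i → trans (length-map (lookup xs i ∷_) (orderings (removeAt xs i)))
                        (length-orderings (removeAt xs i)))
           (allFin (suc m)))
        (cong (_* m !) (length-tabulate {n = suc m} id))

orderings-nonZero : ∀ {A : Set} {m} (xs : Vec A m) → NonZero (length (orderings xs))
orderings-nonZero {m = m} xs = subst NonZero (sym (length-orderings xs)) (m !≢0)

-- The probability that a uniformly random ordering of xs satisfies P.
Pr : ∀ {A : Set} {P : Pred (List A) 0ℓ} → Decidable P → List A → ℚ
Pr P? xs =
  _/_ (+ length (filter P? os)) (length os) {{orderings-nonZero (fromList xs)}}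
  where os = orderings (fromList xs)

successProbability : ∀ {n} → StreamingAlgorithm n → (q t : ℕ) → Graph n → ℚ
successProbability A q t G =
  Pr (λ stream → distinguishes? q t (χ G) (run A stream)) (edges G)

2^-_ : ℕ → ℚ
2^- k = _/_ (+ 1) (2 ^ k) {{m^n≢0 2 k}}

-- f(n) = Ω(n).  An integer-valued f is no restriction: ⌊g(n)⌋ = Ω(n) whenever
-- g(n) = Ω(n), and 2^(-g(n)) ≤ 2^(-⌊g(n)⌋).
IsΩ[n] : (ℕ → ℕ) → Set
IsΩ[n] f = ∃[ d ] ∃[ n₀ ] (∀ n → n₀ ≤ n → n ≤ d * f n)

-- s(q,t,n) ≤ C · (log n)^k · n^(1+1/t) for all large n, where C, k and the
-- threshold do not depend on q and t.  Both sides are raised to the power t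
-- to avoid the root; this is an equivalence because t ≥ 1.
IsÕ[n^1+1/t] : (ℕ → ℕ → ℕ → ℕ) → Set
IsÕ[n^1+1/t] s =
  ∃[ C ] ∃[ k ] ∃[ n₀ ] (∀ q t n → 2 ≤ q → 2 ≤ t → n₀ ≤ n →
    s q t n ^ t ≤ (C * ⌈log₂ n ⌉ ^ k) ^ t * n ^ (t + 1))

{-# OPTIONS --safe #-}
module Submission where

-- Until it has completed t blocks of M edges each, the algorithm keeps an edge
-- iff it is monochromatic under a q-colouring of each block completed before.
-- It answers "small" iff all the blocks, including the unfinished one, are
-- q-colourable.  If χ(G) ≤ q, this is always right.  If fewer than t blocks were
-- completed and all are q-colourable, then every edge is properly coloured by
-- one of at most t colourings, so their product is a proper colouring of G.
--
-- So the algorithm can only fail by completing t blocks.  Fix the t colourings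
-- in advance and call an edge live if the first i of them leave it
-- monochromatic.  If at least a fraction 1/r of the live edges to come is
-- monochromatic under the next colouring, then the next M live edges avoid
-- these with probability at most (1 - 1/r)^M; otherwise the number of live
-- edges drops by a factor of r.  There are fewer than M r^(t-1) edges to start
-- with, so after t - 1 such drops not enough are left for the last block.  With
-- r ≈ n^(1/t) and M ≈ r n log n the bound (1 - 1/r)^M survives the union bound
-- over all q^(n t) ≤ n^n tuples of colourings.

open import Data.Nat.Base using (ℕ; _≤_)
open import Data.Product.Base using (Σ-syntax; ∃-syntax; _×_)
open import Data.Rational.Base using (1ℚ; _-_) renaming (_≤_ to _≤ℚ_)
open import Defs

import Algebra.Properties.CommutativeSemigroup as CommutativeSemigroup
open import Data.Bool.Base using (Bool; true; false; _∧_; if_then_else_)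
import Data.Bool.Properties as Bool
open import Data.Fin.Base using (Fin; zero; suc; toℕ; fromℕ<; inject≤; combine; remQuot)
open import Data.Fin.Properties
  using (_≟_; <-cmp; 2↔Bool; combine-injective; combine-remQuot; inject≤-injective;
         toℕ-inject≤; fromℕ<-toℕ; toℕ<n)
  renaming (_<?_ to _<ᶠ?_)
import Data.Integer.Base as ℤ
import Data.Integer.Properties as ℤ
open import Data.List.Base
  using (List; []; _∷_; _++_; map; concatMap; length; filter; foldl; allFin;
         cartesianProduct; cartesianProductWith)
open import Data.List.Properties
  using (map-++; map-∘; map-cong; map-tabulate; length-++; length-map; length-tabulate; length-filter)
open import Data.List.Membership.Propositional using (_∈_)
open import Data.List.Membership.Propositional.Properties
  using (∈-filter⁺; ∈-filter⁻; ∈-cartesianProduct⁺; ∈-cartesianProductWith⁺; ∈-allFin;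
         ∈-concatMap⁻; ∈-map⁻)
open import Data.List.Relation.Binary.Permutation.Propositional as Perm
  using (_↭_; ↭-refl; ↭-sym; ↭-trans; ↭-reflexive)
open import Data.List.Relation.Binary.Permutation.Propositional.Properties using (∈-resp-↭)
open import Data.List.Relation.Unary.All as All using (All; []; _∷_; all?; universal)
open import Data.List.Relation.Unary.Any using (here; there; satisfied)
open import Data.Nat.Base
open import Data.Nat.Induction using (<-rec)
open import Data.Nat.ListAction using (sum)
open import Data.Nat.ListAction.Properties using (sum-++)
open import Data.Nat.Logarithm using (⌈log₂_⌉; ⌈log₂⌉-mono-≤; ⌈log₂⌈n/2⌉⌉≡⌈log₂n⌉∸1)
open import Data.Nat.Properties hiding (_≟_; <-cmp)
open import Data.Nat.Tactic.RingSolver using (solve-∀)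
open import Data.Product.Base using (_,_; proj₁; proj₂)
import Data.Rational.Base as ℚ
import Data.Rational.Properties as ℚ
import Data.Rational.Unnormalised.Base as ℚᵘ
import Data.Rational.Unnormalised.Properties as ℚᵘ
open import Data.Sum.Base as Sum using (_⊎_; inj₁; inj₂)
open import Data.Vec.Base as Vec
  using (Vec; []; _∷_; lookup; removeAt; toList; fromList; tabulate; take; drop)
open import Data.Vec.Properties using (lookup∘tabulate; toList∘fromList; take++drop≡id; ++-injective)
import Data.Vec.Relation.Unary.Any as AnyV
open import Function.Base using (_∘_; id)
open import Function.Bundles using (Inverse)
open import Level using (0ℓ)
open import Relation.Binary.Definitions using (tri<; tri≈; tri>)
open import Relation.Binary.PropositionalEquality
open import Relation.Nullary.Decidable using (Dec; yes; no; does; _×-dec_)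
open import Relation.Nullary.Negation using (contradiction)
open import Relation.Unary using (Pred; Decidable)

open CommutativeSemigroup +-commutativeSemigroup using ()
  renaming (x∙yz≈y∙xz to x+[y+z]≡y+[x+z]; interchange to +-interchange)
open CommutativeSemigroup *-commutativeSemigroup using ()
  renaming (x∙yz≈y∙xz to x*[y*z]≡y*[x*z]; x∙yz≈yx∙z to x*[y*z]≡[y*x]*z;
            xy∙z≈y∙xz to [x*y]*z≡y*[x*z]; xy∙z≈xz∙y to [x*y]*z≡[x*z]*y;
            x∙yz≈z∙xy to x*[y*z]≡z*[x*y]; interchange to *-interchange)

private
  variable
    A B : Set
    a b m n q : ℕ

-- Sums and counts, and averaging over orderings.

Σ⟨_⟩ : (A → ℕ) → List A → ℕ
Σ⟨ f ⟩ xs = sum (map f xs)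

bit : Bool → ℕ
bit b = if b then 1 else 0

# : (A → Bool) → List A → ℕ
# p = Σ⟨ bit ∘ p ⟩

Σ-mono : {f g : A → ℕ} → ∀ xs → (∀ {x} → x ∈ xs → f x ≤ g x) → Σ⟨ f ⟩ xs ≤ Σ⟨ g ⟩ xs
Σ-mono []       f≤g = z≤n
Σ-mono (x ∷ xs) f≤g = +-mono-≤ (f≤g (here refl)) (Σ-mono xs (f≤g ∘ there))

Σ-const : ∀ c (xs : List A) → Σ⟨ (λ _ → c) ⟩ xs ≡ length xs * c
Σ-const c []       = refl
Σ-const c (x ∷ xs) = cong (c +_) (Σ-const c xs)

Σ-concatMap : ∀ (f : B → ℕ) (g : A → List B) xs →
              Σ⟨ f ⟩ (concatMap g xs) ≡ Σ⟨ (λ x → Σ⟨ f ⟩ (g x)) ⟩ xs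
Σ-concatMap f g []       = refl
Σ-concatMap f g (x ∷ xs) = begin
  sum (map f (g x ++ concatMap g xs))          ≡⟨ cong sum (map-++ f (g x) _) ⟩
  sum (map f (g x) ++ map f (concatMap g xs))  ≡⟨ sum-++ (map f (g x)) _ ⟩
  Σ⟨ f ⟩ (g x) + Σ⟨ f ⟩ (concatMap g xs)       ≡⟨ cong (Σ⟨ f ⟩ (g x) +_) (Σ-concatMap f g xs) ⟩
  Σ⟨ f ⟩ (g x) + Σ⟨ (λ x → Σ⟨ f ⟩ (g x)) ⟩ xs  ∎
  where open ≡-Reasoning

Σ-*ʳ : ∀ (f : A → ℕ) c xs → Σ⟨ f ⟩ xs * c ≡ Σ⟨ (λ x → f x * c) ⟩ xs
Σ-*ʳ f c []       = refl
Σ-*ʳ f c (x ∷ xs) = trans (*-distribʳ-+ c (f x) _) (cong (f x * c +_) (Σ-*ʳ f c xs))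

#≤length : ∀ (p : A → Bool) xs → # p xs ≤ length xs
#≤length p []       = z≤n
#≤length p (x ∷ xs) with p x
... | true  = s≤s (#≤length p xs)
... | false = m≤n⇒m≤1+n (#≤length p xs)

vsum : (A → ℕ) → Vec A m → ℕ
vsum w xs = Vec.sum (Vec.map w xs)

#ᵛ : (A → Bool) → Vec A m → ℕ
#ᵛ p = vsum (bit ∘ p)

vsum-removeAt : ∀ (w : A → ℕ) (xs : Vec A (suc m)) i →
                vsum w xs ≡ w (lookup xs i) + vsum w (removeAt xs i)
vsum-removeAt           w (x ∷ xs)     zero    = refl
vsum-removeAt {m = suc m} w (x ∷ xs@(_ ∷ _)) (suc i) = begin
  w x + vsum w xs                            ≡⟨ cong (w x +_) (vsum-removeAt w xs i) ⟩
  w x + (w (lookup xs i) + vsum w (removeAt xs i))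
    ≡⟨ x+[y+z]≡y+[x+z] (w x) (w (lookup xs i)) _ ⟩
  w (lookup xs i) + (w x + vsum w (removeAt xs i)) ∎
  where open ≡-Reasoning

Σ-allFin : ∀ (w : A → ℕ) (xs : Vec A m) → Σ⟨ w ∘ lookup xs ⟩ (allFin m) ≡ vsum w xs
Σ-allFin {m = zero}  w []       = refl
Σ-allFin {m = suc m} w (x ∷ xs) = cong (w x +_) (trans
  (cong sum (trans (map-tabulate suc (w ∘ lookup (x ∷ xs))) (sym (map-tabulate id (w ∘ lookup xs)))))
  (Σ-allFin w xs))

#-orderings : ∀ (p : List A → Bool) (xs : Vec A (suc m)) →
  # p (orderings xs) ≡
  Σ⟨ (λ i → # (p ∘ (lookup xs i ∷_)) (orderings (removeAt xs i))) ⟩ (allFin (suc m))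
#-orderings {m = m} p xs = trans
  (Σ-concatMap (bit ∘ p) (λ i → map (lookup xs i ∷_) (orderings (removeAt xs i))) (allFin (suc m)))
  (cong sum (map-cong (λ i → cong sum (sym (map-∘ {g = bit ∘ p} {f = lookup xs i ∷_}
                                             (orderings (removeAt xs i)))))
                      (allFin (suc m))))

-- Conditioning on the first element: a bound on the probability that p holds
-- may be proved as an average of bounds on the conditional probabilities.
average : ∀ (p : List A → Bool) (xs : Vec A (suc m)) (w : A → ℕ) a b →
  (∀ i → # (p ∘ (lookup xs i ∷_)) (orderings (removeAt xs i)) * a ≤ w (lookup xs i) * m !) →
  vsum w xs ≤ suc m * b →
  # p (orderings xs) * a ≤ b * (suc m) !
average {m = m} p xs w a b each total = begin
  # p (orderings xs) * a
    ≡⟨ cong (_* a) (#-orderings p xs) ⟩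
  Σ⟨ N ⟩ (allFin (suc m)) * a
    ≡⟨ Σ-*ʳ N a (allFin (suc m)) ⟩
  Σ⟨ (λ i → N i * a) ⟩ (allFin (suc m))
    ≤⟨ Σ-mono (allFin (suc m)) (λ {i} _ → each i) ⟩
  Σ⟨ (λ i → w (lookup xs i) * m !) ⟩ (allFin (suc m))
    ≡⟨ Σ-*ʳ (w ∘ lookup xs) (m !) (allFin (suc m)) ⟨
  Σ⟨ w ∘ lookup xs ⟩ (allFin (suc m)) * m !
    ≡⟨ cong (_* m !) (Σ-allFin w xs) ⟩
  vsum w xs * m !
    ≤⟨ *-monoˡ-≤ (m !) total ⟩
  suc m * b * m !
    ≡⟨ [x*y]*z≡y*[x*z] (suc m) b (m !) ⟩
  b * (suc m) ! ∎
  where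
  open ≤-Reasoning
  N : Fin (suc m) → ℕ
  N i = # (p ∘ (lookup xs i ∷_)) (orderings (removeAt xs i))

vsum-const : ∀ c (xs : Vec A m) → vsum (λ _ → c) xs ≡ m * c
vsum-const c []       = refl
vsum-const c (x ∷ xs) = cong (c +_) (vsum-const c xs)

averageConst : ∀ (p : List A → Bool) (xs : Vec A (suc m)) a b →
  (∀ i → # (p ∘ (lookup xs i ∷_)) (orderings (removeAt xs i)) * a ≤ b * m !) →
  # p (orderings xs) * a ≤ b * (suc m) !
averageConst p xs a b each = average p xs (λ _ → b) a b each (≤-reflexive (vsum-const b xs))

#-false : ∀ (xs : List A) → # (λ _ → false) xs ≡ 0
#-false xs = trans (Σ-const 0 xs) (*-zeroʳ (length xs))

#ᵛ-removeAt : ∀ (p : A → Bool) (xs : Vec A (suc m)) i {b} → p (lookup xs i) ≡ b →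
              #ᵛ p xs ≡ bit b + #ᵛ p (removeAt xs i)
#ᵛ-removeAt p xs i refl = vsum-removeAt (bit ∘ p) xs i

-- Survival of random orderings through fixed phases.

module Survival {A : Set} (M : ℕ) where

  -- Phases are run with predicates bad₁, bad₂, … fixed in advance.  Each
  -- phase waits for M elements that were bad in all the earlier phases (the
  -- live ones, U), and the stream survives if none of those that are awaited
  -- is bad in the current phase and all the phases are completed.
  survive : ∀ {j} → (A → Bool) → Vec (A → Bool) j → ℕ → List A → Bool
  survive U []         k       s       = true
  survive U (bad ∷ vs) zero    s       = survive (λ x → bad x ∧ U x) vs M s
  survive U (bad ∷ vs) (suc k) []      = false
  survive U (bad ∷ vs) (suc k) (x ∷ s) =
    if U x then (if bad x then false else survive U (bad ∷ vs) k s)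
    else survive U (bad ∷ vs) (suc k) s

  survivors : ∀ {j} → (A → Bool) → Vec (A → Bool) j → ℕ → Vec A m → ℕ
  survivors U vs k xs = # (survive U vs k) (orderings xs)

  none : ∀ (xs : List (List A)) a b → # (λ _ → false) xs * a ≤ b
  none xs a b = subst (λ z → z * a ≤ b) (sym (#-false xs)) z≤n

  -- As long as a fraction of at least 1/r of the live elements is bad, each
  -- awaited element is harmless with probability at most (r - 1)/r.
  hit : ∀ {j} a U bad (vs : Vec (A → Bool) j) k (xs : Vec A m) →
    #ᵛ U xs ≤ suc a * #ᵛ (λ x → bad x ∧ U x) xs →
    survivors U (bad ∷ vs) k xs * suc a ^ k ≤ a ^ k * m !
  hit {m = m} a U bad vs zero xs h = begin
    survivors U (bad ∷ vs) 0 xs * 1  ≡⟨ *-identityʳ _ ⟩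
    survivors U (bad ∷ vs) 0 xs      ≤⟨ #≤length _ (orderings xs) ⟩
    length (orderings xs)            ≡⟨ length-orderings xs ⟩
    m !                              ≡⟨ *-identityˡ _ ⟨
    1 * m !                          ∎
    where open ≤-Reasoning
  hit a U bad vs (suc k) [] h = z≤n
  hit {m = suc m} a U bad vs (suc k) xs h =
    -- Compared with `a ^ suc k`, the weight `w` gains a^k on each live element and loses (1 + a)
    -- a^k on each bad live one. By `h` the total change is not positive; the loss is added to both
    -- sides to avoid subtraction.
    average (survive U (bad ∷ vs) (suc k)) xs w (suc a ^ suc k) (a ^ suc k) each
      (+-cancelʳ-≤ (suc a * a ^ k * #ᵛ bad∧U xs) _ _ (begin
        vsum w xs + suc a * a ^ k * #ᵛ bad∧U xs        ≡⟨ total xs ⟩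
        suc m * a ^ suc k + a ^ k * #ᵛ U xs
          ≤⟨ +-monoʳ-≤ (suc m * a ^ suc k) (*-monoʳ-≤ (a ^ k) h) ⟩
        suc m * a ^ suc k + a ^ k * (suc a * #ᵛ bad∧U xs)
          ≡⟨ cong (suc m * a ^ suc k +_) (x*[y*z]≡[y*x]*z (a ^ k) (suc a) (#ᵛ bad∧U xs)) ⟩
        suc m * a ^ suc k + suc a * a ^ k * #ᵛ bad∧U xs ∎))
    where
    open ≤-Reasoning
    bad∧U : A → Bool
    bad∧U x = bad x ∧ U x

    -- The conditional bound by type of first element, scaled by (1 + a)^(k+1): a live bad element
    -- ends survival, a live harmless one leaves `k` to await, and any other changes nothing.
    w : A → ℕ
    w x = if U x then (if bad x then 0 else suc a * a ^ k) else a ^ suc k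

    not-live : ∀ a y → a * y + (1 + a) * y * 0 ≡ a * y + y * 0
    not-live = solve-∀

    pointwise : ∀ x → w x + suc a * a ^ k * bit (bad∧U x) ≡ a ^ suc k + a ^ k * bit (U x)
    pointwise x with U x | bad x
    ... | true  | true  = identity a (a ^ k)
      where
      identity : ∀ a y → (1 + a) * y * 1 ≡ a * y + y * 1
      identity = solve-∀
    ... | true  | false = identity a (a ^ k)
      where
      identity : ∀ a y → (1 + a) * y + (1 + a) * y * 0 ≡ a * y + y * 1
      identity = solve-∀
    ... | false | true  = not-live a (a ^ k)
    ... | false | false = not-live a (a ^ k)

    total : ∀ {l} (ys : Vec A l) →
      vsum w ys + suc a * a ^ k * #ᵛ bad∧U ys ≡ l * a ^ suc k + a ^ k * #ᵛ U ys
    total [] = trans (*-zeroʳ (suc a * a ^ k)) (sym (*-zeroʳ (a ^ k)))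
    total {suc l} (y ∷ ys) = trans
      (distribute (w y) (vsum w ys) (suc a * a ^ k) (bit (bad∧U y)) (#ᵛ bad∧U ys))
      (trans (cong₂ _+_ (pointwise y) (total ys))
             (collect (a ^ suc k) (a ^ k) (bit (U y)) (l * a ^ suc k) (#ᵛ U ys)))
      where
      distribute : ∀ p q r s t → (p + q) + r * (s + t) ≡ (p + r * s) + (q + r * t)
      distribute = solve-∀
      collect : ∀ p q r s t → (p + q * r) + (s + q * t) ≡ (p + s) + q * (r + t)
      collect = solve-∀

    each : ∀ i → # (survive U (bad ∷ vs) (suc k) ∘ (lookup xs i ∷_)) (orderings (removeAt xs i))
                   * suc a ^ suc k ≤ w (lookup xs i) * m !
    each i with U (lookup xs i) in eqU | bad (lookup xs i) in eqB
    ... | true  | true  = none (orderings (removeAt xs i)) (suc a ^ suc k) _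
    ... | true  | false = begin
      N * (suc a * suc a ^ k)  ≡⟨ x*[y*z]≡y*[x*z] N (suc a) (suc a ^ k) ⟩
      suc a * (N * suc a ^ k)  ≤⟨ *-monoʳ-≤ (suc a) (hit a U bad vs k (removeAt xs i) h′) ⟩
      suc a * (a ^ k * m !)    ≡⟨ *-assoc (suc a) (a ^ k) (m !) ⟨
      suc a * a ^ k * m !      ∎
      where
      N = survivors U (bad ∷ vs) k (removeAt xs i)
      -- Losing a live harmless element can only raise the fraction of bad ones.
      h′ : #ᵛ U (removeAt xs i) ≤ suc a * #ᵛ bad∧U (removeAt xs i)
      h′ = begin
        #ᵛ U (removeAt xs i)              ≤⟨ n≤1+n _ ⟩
        suc (#ᵛ U (removeAt xs i))        ≡⟨ #ᵛ-removeAt U xs i eqU ⟨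
        #ᵛ U xs                           ≤⟨ h ⟩
        suc a * #ᵛ bad∧U xs               ≡⟨ cong (suc a *_) (#ᵛ-removeAt bad∧U xs i (cong₂ _∧_ eqB eqU)) ⟩
        suc a * #ᵛ bad∧U (removeAt xs i)  ∎
    ... | false | b = hit a U bad vs (suc k) (removeAt xs i) (begin
      #ᵛ U (removeAt xs i)              ≡⟨ #ᵛ-removeAt U xs i eqU ⟨
      #ᵛ U xs                           ≤⟨ h ⟩
      suc a * #ᵛ bad∧U xs               ≡⟨ cong (suc a *_) (#ᵛ-removeAt bad∧U xs i (trans (cong₂ _∧_ eqB eqU) (Bool.∧-zeroʳ b))) ⟩
      suc a * #ᵛ bad∧U (removeAt xs i)  ∎)

  -- Reading elements never increases the number that will be live in the next phase. So `h` still
  -- holds when the current phase ends, `next` applies there, and averaging carries its bound back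
  -- unchanged.
  pass : ∀ {j} U bad (vs : Vec (A → Bool) j) T a b →
    (∀ {m} (xs : Vec A m) → #ᵛ (λ x → bad x ∧ U x) xs < T →
       survivors (λ x → bad x ∧ U x) vs M xs * a ≤ b * m !) →
    ∀ k (xs : Vec A m) → #ᵛ (λ x → bad x ∧ U x) xs < T →
    survivors U (bad ∷ vs) k xs * a ≤ b * m !
  pass U bad vs T a b next zero    xs h = next xs h
  pass U bad vs T a b next (suc k) [] h = z≤n
  pass {m = suc m} U bad vs T a b next (suc k) xs h = averageConst _ xs a b each
    where
    fewer : ∀ i → #ᵛ (λ x → bad x ∧ U x) (removeAt xs i) < T
    fewer i = ≤-<-trans
      (≤-trans (m≤n+m _ _) (≤-reflexive (sym (vsum-removeAt (bit ∘ (λ x → bad x ∧ U x)) xs i)))) h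
    each : ∀ i → # (survive U (bad ∷ vs) (suc k) ∘ (lookup xs i ∷_)) (orderings (removeAt xs i)) * a
                 ≤ b * m !
    each i with U (lookup xs i) | bad (lookup xs i)
    ... | true  | true  = none (orderings (removeAt xs i)) a _
    ... | true  | false = pass U bad vs T a b next k (removeAt xs i) (fewer i)
    ... | false | _     = pass U bad vs T a b next (suc k) (removeAt xs i) (fewer i)

  -- Each awaited element lowers both `k` and the number of live elements by one, so the phase never
  -- completes and there are no survivors at all.
  exhausted : ∀ {j} U bad (vs : Vec (A → Bool) j) a b k (xs : Vec A m) → #ᵛ U xs < k →
    survivors U (bad ∷ vs) k xs * a ≤ b * m !
  exhausted U bad vs a b (suc k) [] h = z≤n
  exhausted {m = suc m} U bad vs a b (suc k) xs h = averageConst _ xs a b each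
    where
    each : ∀ i → # (survive U (bad ∷ vs) (suc k) ∘ (lookup xs i ∷_)) (orderings (removeAt xs i)) * a
                 ≤ b * m !
    each i with U (lookup xs i) in eq | bad (lookup xs i)
    ... | true  | true  = none (orderings (removeAt xs i)) a _
    ... | true  | false = exhausted U bad vs a b k (removeAt xs i)
                            (≤-pred (subst (_< suc k) (#ᵛ-removeAt U xs i eq) h))
    ... | false | _     = exhausted U bad vs a b (suc k) (removeAt xs i)
                            (subst (_< suc k) (#ᵛ-removeAt U xs i eq) h)

  -- Induction on the phases. Either few live elements are bad, and the hypothesis passes to the
  -- next phase with one factor `suc a` less, or `hit` already yields the whole bound in this phase.
  -- If the last phase is reached, fewer than `M` elements are live.
  survivors-bound : ∀ {j} a U (vs : Vec (A → Bool) (suc j)) (xs : Vec A m) →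
    #ᵛ U xs < M * suc a ^ j → survivors U vs M xs * suc a ^ M ≤ a ^ M * m !
  survivors-bound {j = zero}  a U (bad ∷ vs) xs h =
    exhausted U bad vs (suc a ^ M) (a ^ M) M xs (subst (#ᵛ U xs <_) (*-identityʳ M) h)
  survivors-bound {j = suc j} a U (bad ∷ vs) xs h
    with #ᵛ (λ x → bad x ∧ U x) xs <? M * suc a ^ j
  ... | yes few = pass U bad vs (M * suc a ^ j) (suc a ^ M) (a ^ M)
                    (survivors-bound a (λ x → bad x ∧ U x) vs) M xs few
  ... | no many = hit a U bad vs M xs (begin
      #ᵛ U xs                                ≤⟨ <⇒≤ h ⟩
      M * (suc a * suc a ^ j)                ≡⟨ x*[y*z]≡y*[x*z] M (suc a) (suc a ^ j) ⟩
      suc a * (M * suc a ^ j)                ≤⟨ *-monoʳ-≤ (suc a) (≮⇒≥ many) ⟩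
      suc a * #ᵛ (λ x → bad x ∧ U x) xs      ∎)
    where open ≤-Reasoning

-- Orderings as permutations.

toList-removeAt : ∀ (xs : Vec A (suc m)) i → lookup xs i ∷ toList (removeAt xs i) ↭ toList xs
toList-removeAt (x ∷ xs)           zero    = ↭-refl
toList-removeAt (x ∷ xs@(_ ∷ _)) (suc i) =
  ↭-trans (Perm.swap (lookup xs i) x ↭-refl) (Perm.prep x (toList-removeAt xs i))

orderings-↭ : ∀ (xs : Vec A m) {s} → s ∈ orderings xs → s ↭ toList xs
orderings-↭ {m = zero}  []  (here refl) = ↭-refl
orderings-↭ {m = suc m} xs s∈
  with i , s∈ᵢ ← satisfied (∈-concatMap⁻ (λ i → map (lookup xs i ∷_) (orderings (removeAt xs i)))
                                         {xs = allFin (suc m)} s∈)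
  with s′ , s′∈ , refl ← ∈-map⁻ (lookup xs i ∷_) s∈ᵢ =
  ↭-trans (Perm.prep (lookup xs i) (orderings-↭ (removeAt xs i) s′∈)) (toList-removeAt xs i)

-- Colourings and their products.

-- Vectors rather than functions, so that `anyVec?` can search the colourings and `words` can
-- enumerate them.
Colouring : ℕ → ℕ → Set
Colouring q n = Vec (Fin q) n

mono : Colouring q n → Edge n → Bool
mono c (u , v) = does (lookup c u ≟ lookup c v)

ProperOn : Colouring q n → List (Edge n) → Set
ProperOn c = All (λ e → mono c e ≡ false)

≢⇒mono-false : ∀ (c : Colouring q n) {u v} → lookup c u ≢ lookup c v → mono c (u , v) ≡ false
≢⇒mono-false c {u} {v} cu≢cv with lookup c u ≟ lookup c v
... | yes cu≡cv = contradiction cu≡cv cu≢cv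
... | no  _     = refl

mono-false⇒≢ : ∀ (c : Colouring q n) {u v} → mono c (u , v) ≡ false → lookup c u ≢ lookup c v
mono-false⇒≢ c {u} {v} eq with lookup c u ≟ lookup c v
mono-false⇒≢ c () | yes _
... | no cu≢cv = cu≢cv

∈-edges : ∀ (G : Graph n) {u v} → Adj G u v → (u , v) ∈ edges G ⊎ (v , u) ∈ edges G
∈-edges G {u} {v} uv with <-cmp u v
... | tri< u<v _ _ = inj₁ (∈-filter⁺ _ (∈-cartesianProduct⁺ (∈-allFin u) (∈-allFin v)) (u<v , uv))
... | tri≈ _ u≡v _ = contradiction uv (irrefl G u≡v)
... | tri> _ _ v<u = inj₂ (∈-filter⁺ _ (∈-cartesianProduct⁺ (∈-allFin v) (∈-allFin u)) (v<u , symm G uv))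

edges⇒Adj : ∀ (G : Graph n) {e} → e ∈ edges G → Adj G (proj₁ e) (proj₂ e)
edges⇒Adj {n} G e∈ = proj₂ (proj₂ (∈-filter⁻
  (λ e → (proj₁ e <ᶠ? proj₂ e) ×-dec Adj? G (proj₁ e) (proj₂ e))
  {xs = cartesianProduct (allFin n) (allFin n)} e∈))

colourable-mono : ∀ (G : Graph n) {k l} → k ≤ l → Colourable G k → Colourable G l
colourable-mono G k≤l (c , proper) =
  (λ u → inject≤ (c u) k≤l) , λ u v uv eq → proper u v uv (inject≤-injective k≤l k≤l _ _ eq)

product : ∀ {j} → Vec (Colouring q n) j → Fin n → Fin (q ^ j)
product []       u = zero
product (c ∷ cs) u = combine (lookup c u) (product cs u)

product-separates : ∀ {j} (cs : Vec (Colouring q n) j) {u v} →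
  AnyV.Any (λ c → mono c (u , v) ≡ false) cs → product cs u ≢ product cs v
product-separates (c ∷ cs) {u} {v} (AnyV.here eq) pu≡pv =
  mono-false⇒≢ c eq (proj₁ (combine-injective (lookup c u) (product cs u) (lookup c v) (product cs v) pu≡pv))
product-separates (c ∷ cs) {u} {v} (AnyV.there a) pu≡pv =
  product-separates cs a (proj₂ (combine-injective (lookup c u) (product cs u) (lookup c v) (product cs v) pu≡pv))

product-colourable : ∀ {j} (G : Graph n) (cs : Vec (Colouring q n) j) →
  (∀ {e} → e ∈ edges G → AnyV.Any (λ c → mono c e ≡ false) cs) → Colourable G (q ^ j)
product-colourable G cs separated = product cs , λ u v uv → helper u v (∈-edges G uv)
  where
  helper : ∀ u v → (u , v) ∈ edges G ⊎ (v , u) ∈ edges G → product cs u ≢ product cs v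
  helper u v (inj₁ e∈) = product-separates cs (separated e∈)
  helper u v (inj₂ e∈) = product-separates cs (separated e∈) ∘ sym

foldl-preserves : ∀ {f : B → A → B} {P : A → Set} (I : B → Set) →
  (∀ {y x} → P x → I y → I (f y x)) → ∀ {y xs} → All P xs → I y → I (foldl f y xs)
foldl-preserves I pres []       i = i
foldl-preserves I pres (p ∷ ps) i = foldl-preserves I pres ps (pres p i)

-- The algorithm on unencoded states.

module Algorithm (q t′ M′ n : ℕ) where

  t M : ℕ
  t = suc t′
  M = suc M′

  open Survival {A = Edge n} M

  Block : Set
  Block = List (Edge n)

  -- The completed blocks, latest first, and the unfinished block.
  State : Set
  State = List Block × Block

  HasColouring : Block → Set
  HasColouring b = ∃[ c ] ProperOn {q} c b

  colour? : ∀ b → Dec (HasColouring b)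
  colour? b = anyVec? n λ c → all? (λ e → mono c e Bool.≟ false) b

  -- Colourings are not stored: the same one is recomputed from its block whenever it is needed. The
  -- default for an uncolourable block is harmless, because the answer will then be `large`.
  monoᵇ : ∀ {b} → Dec (HasColouring b) → Edge n → Bool
  monoᵇ (yes (c , _)) = mono c
  monoᵇ (no _)        = λ _ → true

  live : List Block → Edge n → Bool
  live []       e = true
  live (b ∷ bs) e = monoᵇ (colour? b) e ∧ live bs e

  -- After `t` completed blocks the state freezes, which keeps its size bounded. The test against
  -- `M` counts the incoming edge, so a block closes with exactly `M` edges.
  next : State → Edge n → State
  next (bs , buf) e with length bs <? t | live bs e | suc (length buf) <? M
  ... | no  _ | _     | _     = bs , buf
  ... | yes _ | false | _     = bs , buf
  ... | yes _ | true  | yes _ = bs , e ∷ buf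
  ... | yes _ | true  | no  _ = (e ∷ buf) ∷ bs , []

  blocks : State → List Block
  blocks (bs , buf) = buf ∷ bs

  answer : State → Answer
  answer st with all? colour? (blocks st)
  ... | yes _ = small
  ... | no  _ = large

  start : State
  start = [] , []

  full-stays : ∀ bs buf s → length bs ≡ t → foldl next (bs , buf) s ≡ (bs , buf)
  full-stays bs buf []      eq = refl
  full-stays bs buf (e ∷ s) eq with length bs <? t
  ... | yes bs<t = contradiction eq (<⇒≢ bs<t)
  ... | no  _    = full-stays bs buf s eq

  -- The colourings cs either are survived by the rest s of the stream, when the
  -- phases run with the blocks still to come, or account for all of s.
  Recorded : ∀ {j} → List Block → Vec (Colouring q n) (suc j) → ℕ → List (Edge n) → Set
  Recorded bs cs k s =
    survive (live bs) (Vec.map mono cs) k s ≡ true ⊎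
    (∀ {e} → e ∈ s → live bs e ≡ false ⊎ AnyV.Any (λ c → mono c e ≡ false) cs)

  -- The colouring has to be the one that `live` uses, so `h` serves only to exclude the `no`
  -- branch.
  pick : ∀ {b} → HasColouring b → ∃[ c ] (ProperOn c b × monoᵇ (colour? b) ≡ mono c)
  pick {b} h with colour? b
  ... | yes (c , proper) = c , proper , refl
  ... | no  ¬h           = contradiction h ¬h

  -- Induction on the stream, with `suc k` edges missing from the current block and `j` blocks to
  -- follow it. The colouring of the current block is settled only when that block closes or the
  -- stream ends; hence it is a result of the recursion, proper on what is already in `buf`.
  trace : ∀ j k bs buf s → suc j + length bs ≡ t → suc k + length buf ≡ M →
    All HasColouring (blocks (foldl next (bs , buf) s)) →
    All HasColouring bs × Σ[ c ∈ Colouring q n ] Σ[ cs ∈ Vec (Colouring q n) j ]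
      (ProperOn c buf × Recorded bs (c ∷ cs) (suc k) s)
  trace j k bs buf [] eqt eqk ((c , proper) ∷ hs) =
    -- The stream ends inside this block. Copies of its colouring fill the slots of the blocks that
    -- never began.
    hs , c , Vec.replicate j c , proper , inj₂ λ ()
  trace j k bs buf (e ∷ s) eqt eqk hs
    with length bs <? t | live bs e in eqL | suc (length buf) <? M
  ... | no  bs≮t | _ | _ = contradiction (m+n≤o⇒n≤o j (≤-reflexive (trans (+-suc j _) eqt))) bs≮t
  ... | yes _ | false | _ with trace j k bs buf s eqt eqk hs
  ...   | hbs , c , cs , proper , inj₁ sv = hbs , c , cs , proper , inj₁ sv
  ...   | hbs , c , cs , proper , inj₂ f  = hbs , c , cs , proper ,
    inj₂ λ { (here refl) → inj₁ eqL ; (there e∈) → f e∈ }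
  trace j zero bs buf (e ∷ s) eqt eqk hs | yes _ | true | yes room =
    contradiction eqk (<⇒≢ room)
  trace j (suc k) bs buf (e ∷ s) eqt eqk hs | yes _ | true | yes room
    with trace j k bs (e ∷ buf) s eqt (trans (cong suc (+-suc k _)) eqk) hs
  ... | hbs , c , cs , ce ∷ proper , inj₁ sv = hbs , c , cs , proper ,
    inj₁ (trans (cong (if_then false else survive (live bs) (Vec.map mono (c ∷ cs)) (suc k) s) ce) sv)
  ... | hbs , c , cs , ce ∷ proper , inj₂ f  = hbs , c , cs , proper ,
    inj₂ λ { (here refl) → inj₂ (AnyV.here ce) ; (there e∈) → f e∈ }
  trace j (suc k) bs buf (e ∷ s) eqt eqk hs | yes _ | true | no ¬room =
    contradiction (≤-trans (s≤s (s≤s (m≤n+m _ k))) (≤-reflexive eqk)) ¬room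
  trace zero zero bs buf (e ∷ s) eqt eqk hs | yes _ | true | no ¬room
    -- This edge closes block number `t`. The rest of the stream is ignored, so the colourability of
    -- that block can be read off the final state.
    with _ ∷ hb ∷ hbs ← subst (All HasColouring ∘ blocks) (full-stays ((e ∷ buf) ∷ bs) [] s eqt) hs
    with c , ce ∷ proper , _ ← pick hb =
    hbs , c , [] , proper , inj₁ (cong (if_then false else true) ce)
  trace (suc j) zero bs buf (e ∷ s) eqt eqk hs | yes _ | true | no ¬room
    with trace j M′ ((e ∷ buf) ∷ bs) [] s (trans (cong suc (+-suc j _)) eqt) (+-identityʳ M) hs
  ... | hb ∷ hbs , c′ , cs , _ , rec with pick hb
  ... | c , ce ∷ proper , eqm = hbs , c , c′ ∷ cs , proper , extend rec
    where
    -- Survival from the next phase on. The recursion provides it for `monoᵇ` of the closed block,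
    -- and `eqm` trades that for `mono c`.
    after : (Edge n → Bool) → Bool
    after f = survive (λ x → f x ∧ live bs x) (Vec.map mono (c′ ∷ cs)) M s

    split : ∀ x → live ((e ∷ buf) ∷ bs) x ≡ false ⊎ AnyV.Any (λ c → mono c x ≡ false) (c′ ∷ cs) →
            live bs x ≡ false ⊎ AnyV.Any (λ c → mono c x ≡ false) (c ∷ c′ ∷ cs)
    split x (inj₂ a) = inj₂ (AnyV.there a)
    split x (inj₁ p) with mono c x in eqx
    ... | false = inj₂ (AnyV.here eqx)
    ... | true  = inj₁ (trans (cong (_∧ live bs x) (sym (trans (cong (λ f → f x) eqm) eqx))) p)

    extend : Recorded ((e ∷ buf) ∷ bs) (c′ ∷ cs) M s →
      (if mono c e then false else after (mono c)) ≡ true ⊎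
      (∀ {x} → x ∈ e ∷ s → live bs x ≡ false ⊎ AnyV.Any (λ c → mono c x ≡ false) (c ∷ c′ ∷ cs))
    extend (inj₁ sv) = inj₁ (trans (cong (if_then false else after (mono c)) ce)
                                   (subst (λ f → after f ≡ true) eqm sv))
    extend (inj₂ f) = inj₂ λ { (here refl) → inj₂ (AnyV.here ce) ; {x} (there e∈) → split x (f e∈) }

  next-All : ∀ {P : Edge n → Set} {st e} → P e → All (All P) (blocks st) → All (All P) (blocks (next st e))
  next-All {st = bs , buf} {e} p (pb ∷ pbs)
    with length bs <? t | live bs e | suc (length buf) <? M
  ... | no  _ | _     | _     = pb ∷ pbs
  ... | yes _ | false | _     = pb ∷ pbs
  ... | yes _ | true  | yes _ = (p ∷ pb) ∷ pbs
  ... | yes _ | true  | no  _ = [] ∷ (p ∷ pb) ∷ pbs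

  Bounded : State → Set
  Bounded (bs , buf) = length bs ≤ t × length buf < M × All (λ b → length b ≤ M) bs

  next-Bounded : ∀ {st e} → Bounded st → Bounded (next st e)
  next-Bounded {bs , buf} {e} (bs≤t , b , bbs)
    with length bs <? t | live bs e | suc (length buf) <? M
  ... | no  _    | _     | _        = bs≤t , b , bbs
  ... | yes _    | false | _        = bs≤t , b , bbs
  ... | yes _    | true  | yes room = bs≤t , room , bbs
  ... | yes bs<t | true  | no  full = bs<t , z<s , b ∷ bbs

  module _ (G : Graph n) where

    -- Blocks hold only edges of `G`, so a single colouring of `G` serves them all.
    stored-colourable : χ G ≤ q → ∀ s → (∀ {e} → e ∈ s → e ∈ edges G) →
      All HasColouring (blocks (foldl next start s))
    stored-colourable χ≤q s s⊆G = All.map (c ,_)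
      (foldl-preserves (All (All (λ e → mono c e ≡ false)) ∘ blocks) next-All
         (All.tabulate λ e∈ → proper _ _ (edges⇒Adj G (s⊆G e∈))) ([] ∷ []))
      where
      cG = colourable-mono G χ≤q (χ-colourable G)
      c : Colouring q n
      c = tabulate (proj₁ cG)
      proper : ∀ u v → Adj G u v → mono c (u , v) ≡ false
      proper u v uv = ≢⇒mono-false c (subst₂ _≢_ (sym (lookup∘tabulate _ u)) (sym (lookup∘tabulate _ v))
                                        (proj₂ cG u v uv))

    -- The answer `large` is right by the contrapositive of `stored-colourable`. For `small`,
    -- `trace` starts without completed blocks, where every edge is live; so its second alternative
    -- makes the product of the `t` colourings proper. The surviving tuple depends on the order of
    -- the stream, which is why a union bound over all tuples follows.
    correct-or-survives : ∀ s → (∀ {e} → e ∈ s → e ∈ edges G) → (∀ {e} → e ∈ edges G → e ∈ s) →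
      Distinguishes q t (χ G) (answer (foldl next start s)) ⊎
      Σ[ cs ∈ Vec (Colouring q n) t ] survive (λ _ → true) (Vec.map mono cs) M s ≡ true
    correct-or-survives s s⊆G G⊆s with all? colour? (blocks (foldl next start s))
    ... | no  ¬hs = inj₁ ((λ χ≤q → contradiction (stored-colourable χ≤q s s⊆G) ¬hs) , λ _ → refl)
    ... | yes hs with trace t′ M′ [] [] s (+-identityʳ t) (+-identityʳ M) hs
    ...   | _ , c , cs , _ , inj₁ sv = inj₂ (c ∷ cs , sv)
    ...   | _ , c , cs , _ , inj₂ f  = inj₁ ((λ _ → refl) , λ χ>q^t → contradiction
              (χ-minimal G (q ^ t) (product-colourable G (c ∷ cs) separated))
              (<⇒≱ χ>q^t))
      where
      separated : ∀ {e} → e ∈ edges G → AnyV.Any (λ c → mono c e ≡ false) (c ∷ cs)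
      separated e∈ with f (G⊆s e∈)
      ... | inj₂ a = a

-- Encoding states as bit strings.

-- The round trip is not a field, since list codes are faithful on short lists only; it is proved
-- value by value.
record Code (A : Set) (b : ℕ) : Set where
  field
    encode : A → Vec Bool b
    decode : Vec Bool b → A

open Code

RoundTrips : Code A b → A → Set
RoundTrips C x = decode C (encode C x) ≡ x

take-++ : ∀ (xs : Vec A m) (ys : Vec A n) → take m (xs Vec.++ ys) ≡ xs
take-++ {m = m} xs ys = proj₁ (++-injective (take m (xs Vec.++ ys)) xs (take++drop≡id m (xs Vec.++ ys)))

drop-++ : ∀ (xs : Vec A m) (ys : Vec A n) → drop m (xs Vec.++ ys) ≡ ys
drop-++ {m = m} xs ys = proj₂ (++-injective (take m (xs Vec.++ ys)) xs (take++drop≡id m (xs Vec.++ ys)))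

pairCode : Code A a → Code B b → Code (A × B) (a + b)
pairCode {a = a} C D = record
  { encode = λ { (x , y) → encode C x Vec.++ encode D y }
  ; decode = λ v → decode C (take a v) , decode D (drop a v)
  }

pair-roundTrips : ∀ (C : Code A a) (D : Code B b) {x y} →
  RoundTrips C x → RoundTrips D y → RoundTrips (pairCode C D) (x , y)
pair-roundTrips C D {x} {y} p q = cong₂ _,_
  (trans (cong (decode C) (take-++ (encode C x) (encode D y))) p)
  (trans (cong (decode D) (drop-++ (encode C x) (encode D y))) q)

-- Faithful on lists of length at most k; longer lists are truncated.
listCode : ∀ k → Code A b → Code (List A) (k * suc b)
listCode zero    C = record { encode = λ _ → [] ; decode = λ _ → [] }
listCode {b = b} (suc k) C = record
  { encode = λ where
      []       → Vec.replicate (suc k * suc b) false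
      (x ∷ xs) → true ∷ (encode C x Vec.++ encode (listCode k C) xs)
  ; decode = λ where
      (false ∷ v) → []
      (true  ∷ v) → decode C (take b v) ∷ decode (listCode k C) (drop b v)
  }

list-roundTrips : ∀ k (C : Code A b) {xs} → All (RoundTrips C) xs → length xs ≤ k →
                  RoundTrips (listCode k C) xs
list-roundTrips zero    C []       _         = refl
list-roundTrips (suc k) C []       _         = refl
list-roundTrips (suc k) C {x ∷ xs} (p ∷ ps) (s≤s l) = cong₂ _∷_
  (trans (cong (decode C) (take-++ (encode C x) _)) p)
  (trans (cong (decode (listCode k C)) (drop-++ (encode C x) _)) (list-roundTrips k C ps l))

binary : ∀ b → Code (Fin (2 ^ b)) b
binary zero    = record { encode = λ _ → [] ; decode = λ _ → zero }
binary (suc b) = record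
  { encode = λ i → let d , j = remQuot {2} (2 ^ b) i in Inverse.to 2↔Bool d ∷ encode (binary b) j
  ; decode = λ { (x ∷ v) → combine (Inverse.from 2↔Bool x) (decode (binary b) v) }
  }

binary-roundTrips : ∀ b i → RoundTrips (binary b) i
binary-roundTrips zero    zero = refl
binary-roundTrips (suc b) i    = trans
  (cong₂ combine (Inverse.strictlyInverseʳ 2↔Bool (proj₁ (remQuot {2} (2 ^ b) i)))
                 (binary-roundTrips b (proj₂ (remQuot {2} (2 ^ b) i))))
  (combine-remQuot {2} (2 ^ b) i)

-- Makes decoding total: bit strings beyond the range fall back to `zero`.
clamp : ∀ {n} → ℕ → Fin (suc n)
clamp {n} x with x <? suc n
... | yes x<1+n = fromℕ< x<1+n
... | no  _     = zero

clamp-toℕ : ∀ {n} (i : Fin (suc n)) → clamp (toℕ i) ≡ i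
clamp-toℕ {n} i with toℕ i <? suc n
... | yes i<1+n = fromℕ<-toℕ i i<1+n
... | no  i≮1+n = contradiction (toℕ<n i) i≮1+n

finCode : ∀ b → suc n ≤ 2 ^ b → Code (Fin (suc n)) b
finCode b n<2^b = record
  { encode = λ i → encode (binary b) (inject≤ i n<2^b)
  ; decode = λ v → clamp (toℕ (decode (binary b) v))
  }

fin-roundTrips : ∀ b (n<2^b : suc n ≤ 2 ^ b) i → RoundTrips (finCode b n<2^b) i
fin-roundTrips b n<2^b i = trans
  (cong (clamp ∘ toℕ) (binary-roundTrips b (inject≤ i n<2^b)))
  (trans (cong clamp (toℕ-inject≤ i n<2^b)) (clamp-toℕ i))

edgeCode : ∀ b → suc n ≤ 2 ^ b → Code (Edge (suc n)) (b + b)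
edgeCode b n<2^b = pairCode (finCode b n<2^b) (finCode b n<2^b)

edge-roundTrips : ∀ b (n<2^b : suc n ≤ 2 ^ b) e → RoundTrips (edgeCode b n<2^b) e
edge-roundTrips b n<2^b (u , v) =
  pair-roundTrips (finCode b n<2^b) (finCode b n<2^b) (fin-roundTrips b n<2^b u) (fin-roundTrips b n<2^b v)

-- Logarithms and powers.

n≤2^⌈log₂n⌉ : ∀ n → n ≤ 2 ^ ⌈log₂ n ⌉
n≤2^⌈log₂n⌉ = <-rec _ halve
  where
  open ≤-Reasoning
  halve : ∀ n → (∀ {m} → m < n → m ≤ 2 ^ ⌈log₂ m ⌉) → n ≤ 2 ^ ⌈log₂ n ⌉
  halve zero            rec = z≤n
  halve (suc zero)      rec = ≤-refl
  halve n@(suc (suc k)) rec = begin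
    n                          ≡⟨ ⌊n/2⌋+⌈n/2⌉≡n n ⟨
    ⌊ n /2⌋ + ⌈ n /2⌉          ≤⟨ +-monoˡ-≤ _ (⌊n/2⌋≤⌈n/2⌉ n) ⟩
    ⌈ n /2⌉ + ⌈ n /2⌉          ≡⟨ cong (λ x → ⌈ n /2⌉ + x) (+-identityʳ ⌈ n /2⌉) ⟨
    2 * ⌈ n /2⌉                ≤⟨ *-monoʳ-≤ 2 (rec (⌈n/2⌉<n k)) ⟩
    2 ^ suc ⌈log₂ ⌈ n /2⌉ ⌉    ≡⟨ cong (λ l → 2 ^ suc l) (⌈log₂⌈n/2⌉⌉≡⌈log₂n⌉∸1 n) ⟩
    -- Here n is at least 2, so its logarithm is positive and the truncated subtraction is exact.
    2 ^ suc (⌈log₂ n ⌉ ∸ 1)    ≡⟨ cong (2 ^_) (m+[n∸m]≡n (⌈log₂⌉-mono-≤ {2} {n} (s≤s (s≤s z≤n)))) ⟩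
    2 ^ ⌈log₂ n ⌉              ∎

*-^-distrib : ∀ a b k → (a * b) ^ k ≡ a ^ k * b ^ k
*-^-distrib a b zero    = refl
*-^-distrib a b (suc k) = trans (cong (a * b *_) (*-^-distrib a b k)) (*-interchange a b (a ^ k) (b ^ k))

-- (1 + 1/a)^k ≥ 1 + k/a, with denominators cleared.
bernoulli : ∀ a k → a ^ k * (a + k) ≤ suc a ^ k * a
bernoulli a zero    = ≤-reflexive (identity a)
  where
  identity : ∀ a → 1 * (a + 0) ≡ 1 * a
  identity = solve-∀
bernoulli a (suc k) = begin
  a * a ^ k * (a + suc k)                  ≤⟨ m≤m+n _ (a ^ k * k) ⟩
  a * a ^ k * (a + suc k) + a ^ k * k      ≡⟨ identity a k (a ^ k) ⟩
  suc a * (a ^ k * (a + k))                ≤⟨ *-monoʳ-≤ (suc a) (bernoulli a k) ⟩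
  suc a * (suc a ^ k * a)                  ≡⟨ *-assoc (suc a) (suc a ^ k) a ⟨
  suc a * suc a ^ k * a                    ∎
  where
  open ≤-Reasoning
  identity : ∀ a k p → a * p * (a + (1 + k)) + p * k ≡ (1 + a) * (p * (a + k))
  identity = solve-∀

-- Bernoulli with exponent 1 + a: the factor 1 + (1 + a)/a exceeds 2.
2*a^[1+a]≤[1+a]^[1+a] : ∀ a .{{_ : NonZero a}} → 2 * a ^ suc a ≤ suc a ^ suc a
2*a^[1+a]≤[1+a]^[1+a] a = *-cancelʳ-≤ _ _ a (begin
  2 * a ^ suc a * a                    ≤⟨ m≤m+n _ (a ^ suc a) ⟩
  2 * a ^ suc a * a + a ^ suc a        ≡⟨ identity a (a ^ suc a) ⟩
  a ^ suc a * (a + suc a)              ≤⟨ bernoulli a (suc a) ⟩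
  suc a ^ suc a * a                    ∎)
  where
  open ≤-Reasoning
  identity : ∀ a p → 2 * p * a + p ≡ p * (a + (1 + a))
  identity = solve-∀

-- With r = 1 + a this is (1 - 1/r)^(r x) ≤ 2^(-x), denominators cleared.
2^x*a^[1+a]x≤[1+a]^[1+a]x : ∀ a .{{_ : NonZero a}} x →
  2 ^ x * a ^ (suc a * x) ≤ suc a ^ (suc a * x)
2^x*a^[1+a]x≤[1+a]^[1+a]x a x = begin
  2 ^ x * a ^ (suc a * x)    ≡⟨ cong (2 ^ x *_) (^-*-assoc a (suc a) x) ⟨
  2 ^ x * (a ^ suc a) ^ x    ≡⟨ *-^-distrib 2 (a ^ suc a) x ⟨
  (2 * a ^ suc a) ^ x        ≤⟨ ^-monoˡ-≤ x (2*a^[1+a]≤[1+a]^[1+a] a) ⟩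
  (suc a ^ suc a) ^ x        ≡⟨ ^-*-assoc (suc a) (suc a) x ⟩
  suc a ^ (suc a * x)        ∎
  where open ≤-Reasoning

-- Enumeration, the union bound and probabilities.

words : List A → ∀ k → List (Vec A k)
words xs zero    = [] ∷ []
words xs (suc k) = cartesianProductWith _∷_ xs (words xs k)

length-cartesianProductWith : ∀ {C : Set} (f : A → B → C) xs ys →
  length (cartesianProductWith f xs ys) ≡ length xs * length ys
length-cartesianProductWith f []       ys = refl
length-cartesianProductWith f (x ∷ xs) ys = trans (length-++ (map (f x) ys))
  (cong₂ _+_ (length-map (f x) ys) (length-cartesianProductWith f xs ys))

length-words : ∀ (xs : List A) k → length (words xs k) ≡ length xs ^ k
length-words xs zero    = refl
length-words xs (suc k) = trans (length-cartesianProductWith _∷_ xs (words xs k))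
  (cong (length xs *_) (length-words xs k))

∈-words : ∀ {xs : List A} → (∀ x → x ∈ xs) → ∀ {k} (w : Vec A k) → w ∈ words xs k
∈-words all []      = here refl
∈-words all (x ∷ w) = ∈-cartesianProductWith⁺ _∷_ (all x) (∈-words all w)

length-edges : ∀ (G : Graph n) → length (edges G) ≤ n * n
length-edges {n} G = begin
  length (edges G)                                  ≤⟨ length-filter _ (cartesianProduct (allFin n) (allFin n)) ⟩
  length (cartesianProduct (allFin n) (allFin n))   ≡⟨ length-cartesianProductWith _,_ (allFin n) (allFin n) ⟩
  length (allFin n) * length (allFin n)             ≡⟨ cong (λ l → l * l) (length-tabulate {n = n} id) ⟩
  n * n                                             ∎
  where open ≤-Reasoning

Σ-+ : ∀ (f g : A → ℕ) xs → Σ⟨ (λ x → f x + g x) ⟩ xs ≡ Σ⟨ f ⟩ xs + Σ⟨ g ⟩ xs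
Σ-+ f g []       = refl
Σ-+ f g (x ∷ xs) = trans (cong (λ s → f x + g x + s) (Σ-+ f g xs)) (+-interchange (f x) (g x) _ _)

∈⇒≤Σ : ∀ (f : A → ℕ) {xs x} → x ∈ xs → f x ≤ Σ⟨ f ⟩ xs
∈⇒≤Σ f (here refl) = m≤m+n _ _
∈⇒≤Σ f (there x∈)  = ≤-trans (∈⇒≤Σ f x∈) (m≤n+m _ _)

unionBound : ∀ {P : Pred A 0ℓ} (P? : Decidable P) (p : B → A → Bool) (ys : List B) xs →
  (∀ {x} → x ∈ xs → P x ⊎ ∃[ y ] (y ∈ ys × p y x ≡ true)) →
  length xs ≤ length (filter P? xs) + Σ⟨ (λ y → # (p y) xs) ⟩ ys
unionBound P? p ys []       h = z≤n
unionBound {P = P} P? p ys (x ∷ xs) h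
  -- Separates the contribution of `x` from that of `xs`, so that one event containing `x` pays for
  -- it.
  rewrite Σ-+ (λ y → bit (p y x)) (λ y → # (p y) xs) ys
  with P? x | h (here refl)
... | yes _  | _                    =
  s≤s (≤-trans (unionBound P? p ys xs (h ∘ there)) (+-monoʳ-≤ (length (filter P? xs)) (m≤n+m rest hit)))
  where
  hit  = Σ⟨ (λ y → bit (p y x)) ⟩ ys
  rest = Σ⟨ (λ y → # (p y) xs) ⟩ ys
... | no ¬px | inj₁ px              = contradiction px ¬px
... | no ¬px | inj₂ (y , y∈ , pyx)  = begin
  1 + length xs
    ≤⟨ +-mono-≤ (≤-trans (≤-reflexive (sym (cong bit pyx))) (∈⇒≤Σ (λ y → bit (p y x)) y∈))
                (unionBound P? p ys xs (h ∘ there)) ⟩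
  hit + (length (filter P? xs) + rest)
    ≡⟨ x+[y+z]≡y+[x+z] hit (length (filter P? xs)) rest ⟩
  length (filter P? xs) + (hit + rest) ∎
  where
  open ≤-Reasoning
  hit  = Σ⟨ (λ y → bit (p y x)) ⟩ ys
  rest = Σ⟨ (λ y → # (p y) xs) ⟩ ys

1-1/E≤S/D : ∀ S D E .{{_ : NonZero D}} .{{_ : NonZero E}} → D * E ≤ S * E + D →
            1ℚ ℚ.- (ℤ.+ 1 ℚ./ E) ℚ.≤ ℤ.+ S ℚ./ D
1-1/E≤S/D S D@(suc _) E@(suc _) h = begin
  1ℚ ℚ.- e               ≤⟨ ℚ.+-monoˡ-≤ (ℚ.- e) 1≤s+e ⟩
  (s ℚ.+ e) ℚ.- e        ≡⟨ ℚ.+-assoc s e (ℚ.- e) ⟩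
  s ℚ.+ (e ℚ.- e)        ≡⟨ cong (s ℚ.+_) (ℚ.+-inverseʳ e) ⟩
  s ℚ.+ ℚ.0ℚ             ≡⟨ ℚ.+-identityʳ s ⟩
  s                      ∎
  where
  open ℚ.≤-Reasoning
  s = ℤ.+ S ℚ./ D
  e = ℤ.+ 1 ℚ./ E
  -- Fractions in `ℚ` are normalised; on the unnormalised ones the comparison is plain
  -- cross-multiplication, which is `h`.
  sum≃ : ℚ.toℚᵘ (s ℚ.+ e) ℚᵘ.≃ (ℤ.+ S ℚᵘ./ D) ℚᵘ.+ (ℤ.+ 1 ℚᵘ./ E)
  sum≃ = ℚᵘ.≃-trans (ℚ.toℚᵘ-homo-+ s e)
    (ℚᵘ.+-cong (ℚ.toℚᵘ-fromℚᵘ (ℤ.+ S ℚᵘ./ D)) (ℚ.toℚᵘ-fromℚᵘ (ℤ.+ 1 ℚᵘ./ E)))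
  integral : ℤ.+ 1 ℤ.* (ℤ.+ D ℤ.* ℤ.+ E) ℤ.≤ (ℤ.+ S ℤ.* ℤ.+ E ℤ.+ ℤ.+ 1 ℤ.* ℤ.+ D) ℤ.* ℤ.+ 1
  integral = subst₂ ℤ._≤_
    (trans (ℤ.pos-* D E) (sym (ℤ.*-identityˡ _)))
    (trans (ℤ.pos-+ (S * E) D) (trans (cong₂ ℤ._+_ (ℤ.pos-* S E) (sym (ℤ.*-identityˡ (ℤ.+ D)))) (sym (ℤ.*-identityʳ _))))
    (ℤ.+≤+ h)
  1≤s+e : 1ℚ ℚ.≤ s ℚ.+ e
  1≤s+e = ℚ.toℚᵘ-cancel-≤ (ℚᵘ.≤-respʳ-≃ (ℚᵘ.≃-sym sum≃) (ℚᵘ.*≤* integral))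

opaque
  Succeeds : ∀ {n} → StreamingAlgorithm n → (q t : ℕ) → Graph n → Set
  Succeeds {n} A q t G = 1ℚ - (2^- n) ≤ℚ successProbability A q t G

  fewFailures⇒succeeds : ∀ {n} (A : StreamingAlgorithm n) q t (G : Graph n) F →
    let os = orderings (fromList (edges G)) in
    length os ≤ length (filter (λ s → distinguishes? q t (χ G) (run A s)) os) + F →
    F * 2 ^ n ≤ length os →
    Succeeds A q t G
  fewFailures⇒succeeds {n} A q t G F D≤S+F F≤D/2^n =
    1-1/E≤S/D S D (2 ^ n) {{orderings-nonZero (fromList (edges G))}} {{m^n≢0 2 n}} (begin
      D * 2 ^ n              ≤⟨ *-monoˡ-≤ (2 ^ n) D≤S+F ⟩
      (S + F) * 2 ^ n        ≡⟨ *-distribʳ-+ (2 ^ n) S F ⟩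
      S * 2 ^ n + F * 2 ^ n  ≤⟨ +-monoʳ-≤ (S * 2 ^ n) F≤D/2^n ⟩
      S * 2 ^ n + D          ∎)
    where
    open ≤-Reasoning
    D S : ℕ
    D = length (orderings (fromList (edges G)))
    S = length (filter (λ s → distinguishes? q t (χ G) (run A s)) (orderings (fromList (edges G))))

-- The trivial algorithm and the encoded one.

alwaysSmall : ∀ {n} → StreamingAlgorithm n
alwaysSmall = record { space = 0 ; init = [] ; step = λ v _ → v ; output = λ _ → small }

alwaysSmall-succeeds : ∀ q t {n} (G : Graph n) → n ≤ q ^ t →
  Succeeds alwaysSmall q t G
alwaysSmall-succeeds q t {n} G n≤q^t = fewFailures⇒succeeds alwaysSmall q t G 0
  (unionBound {B = ℕ} (λ s → distinguishes? q t (χ G) (run alwaysSmall s)) (λ _ _ → false) []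
    (orderings (fromList (edges G))) λ {s} _ →
      inj₁ (answers-small (foldl (λ v _ → v) [] s)))
  z≤n
  where
  answers-small : ∀ (v : Vec Bool 0) → Distinguishes q t (χ G) (output (alwaysSmall {n}) v)
  answers-small v = (λ _ → refl) , λ χ>q^t →
    contradiction (≤-trans (χ-minimal G n (n-colourable G)) n≤q^t) (<⇒≱ χ>q^t)

-- The code need not be faithful everywhere: the invariant `I` holds at each state reached, and
-- there decoding undoes encoding.
simulates : ∀ {S E : Set} {b} (C : Code S b) (next : S → E → S) (I : S → Set) →
  (∀ {st} → I st → RoundTrips C st) → (∀ {st e} → I st → I (next st e)) →
  ∀ {st} → I st → ∀ s →
  decode C (foldl (λ v e → encode C (next (decode C v) e)) (encode C st) s) ≡ foldl next st s
simulates C next I roundTrips preserved i []      = roundTrips i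
simulates C next I roundTrips preserved {st} i (e ∷ s) = trans
  (cong (λ st′ → decode C (foldl (λ v e → encode C (next (decode C v) e)) (encode C (next st′ e)) s))
        (roundTrips i))
  (simulates C next I roundTrips preserved (preserved i) s)

implement : ∀ {S : Set} {b n} → Code S b → S → (S → Edge n → S) → (S → Answer) → StreamingAlgorithm n
implement {b = b} C start next answer = record
  { space  = b
  ; init   = encode C start
  ; step   = λ v e → encode C (next (decode C v) e)
  ; output = answer ∘ decode C
  }

run-implement : ∀ {S : Set} {b n} (C : Code S b) {start} (next : S → Edge n → S) answer (I : S → Set) →
  (∀ {st} → I st → RoundTrips C st) → (∀ {st e} → I st → I (next st e)) → I start → ∀ s →
  run (implement C start next answer) s ≡ answer (foldl next start s)
run-implement C next answer I roundTrips preserved i s =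
  cong answer (simulates C next I roundTrips preserved i s)

-- The parameter r plays the role of n^(1/t).
module Main (q t′ n′ r : ℕ) where

  N L M′ : ℕ
  N  = suc n′
  L  = ⌈log₂ N ⌉
  -- Every `r` awaited edges halve the chance of survival. `N * L` halvings pay for the number of
  -- tuples, and `N` more give the failure probability 2^(-N).
  M′ = r * (N * suc L)

  open Algorithm q t′ M′ N public

  edgeCode′ : Code (Edge N) (L + L)
  edgeCode′ = edgeCode L (n≤2^⌈log₂n⌉ N)

  blockCode : Code Block (M * suc (L + L))
  blockCode = listCode M edgeCode′

  stateCode : Code State (t * suc (M * suc (L + L)) + M * suc (L + L))
  stateCode = pairCode (listCode t blockCode) blockCode

  algorithm : StreamingAlgorithm N
  algorithm = implement stateCode start next answer

  block-roundTrips : ∀ {b} → length b ≤ M → RoundTrips blockCode b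
  block-roundTrips {b} = list-roundTrips M edgeCode′
    (universal (edge-roundTrips L (n≤2^⌈log₂n⌉ N)) b)

  state-roundTrips : ∀ {st} → Bounded st → RoundTrips stateCode st
  state-roundTrips (bs≤t , buf<M , bbs) = pair-roundTrips (listCode t blockCode) blockCode
    (list-roundTrips t blockCode (All.map block-roundTrips bbs) bs≤t)
    (block-roundTrips (<⇒≤ buf<M))

  run-algorithm : ∀ s → run algorithm s ≡ answer (foldl next start s)
  run-algorithm = run-implement stateCode next answer Bounded state-roundTrips
    (λ {st} {e} → next-Bounded {st} {e}) (z≤n , z<s , [])

-- The failure probability.

module _ (q t′ n′ a : ℕ) .{{_ : NonZero a}} where

  open Main q t′ n′ (suc a)
  open Survival {A = Edge N} M

  tuples : List (Vec (Colouring q N) t)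
  tuples = words (words (allFin q) N) t

  survives : Vec (Colouring q N) t → List (Edge N) → Bool
  survives cs = survive (λ _ → true) (Vec.map mono cs) M

  -- There are q^(N t) = (q^t)^N tuples, at most N^N however large `q` and `t` are.
  length-tuples : q ^ t ≤ N → length tuples ≤ 2 ^ (N * L)
  length-tuples q^t≤N = begin
    length tuples                          ≡⟨ length-words (words (allFin q) N) t ⟩
    length (words (allFin q) N) ^ t        ≡⟨ cong (_^ t) (length-words (allFin q) N) ⟩
    (length (allFin q) ^ N) ^ t            ≡⟨ cong (λ l → (l ^ N) ^ t) (length-tabulate {n = q} id) ⟩
    (q ^ N) ^ t                            ≡⟨ ^-*-assoc q N t ⟩
    q ^ (N * t)                            ≡⟨ cong (q ^_) (*-comm N t) ⟩
    q ^ (t * N)                            ≡⟨ ^-*-assoc q t N ⟨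
    (q ^ t) ^ N                            ≤⟨ ^-monoˡ-≤ N (≤-trans q^t≤N (n≤2^⌈log₂n⌉ N)) ⟩
    (2 ^ L) ^ N                            ≡⟨ ^-*-assoc 2 L N ⟩
    2 ^ (L * N)                            ≡⟨ cong (2 ^_) (*-comm L N) ⟩
    2 ^ (N * L)                            ∎
    where open ≤-Reasoning

  decay : 2 ^ (N * L) * 2 ^ N * a ^ M ≤ suc a ^ M
  decay = begin
    2 ^ (N * L) * 2 ^ N * (a * a ^ M′)     ≡⟨ cong (_* (a * a ^ M′)) (^-distribˡ-+-* 2 (N * L) N) ⟨
    2 ^ (N * L + N) * (a * a ^ M′)         ≡⟨ cong (λ e → 2 ^ e * (a * a ^ M′)) (trans (+-comm (N * L) N) (sym (*-suc N L))) ⟩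
    2 ^ (N * suc L) * (a * a ^ M′)         ≡⟨ x*[y*z]≡y*[x*z] (2 ^ (N * suc L)) a (a ^ M′) ⟩
    a * (2 ^ (N * suc L) * a ^ M′)         ≤⟨ *-mono-≤ (n≤1+n a) (2^x*a^[1+a]x≤[1+a]^[1+a]x a (N * suc L)) ⟩
    suc a * suc a ^ M′                     ∎
    where open ≤-Reasoning

  module _ (N≤r^t : N ≤ suc a ^ t) (q^t≤N : q ^ t ≤ N) (G : Graph N) where

    xs : Vec (Edge N) (length (edges G))
    xs = fromList (edges G)

    os : List (List (Edge N))
    os = orderings xs

    -- One factor N of N² is at most r^t, of which one r goes into `M′`. Strictness comes from `M`
    -- being `suc M′`.
    few-edges : #ᵛ (λ _ → true) xs < M * suc a ^ t′
    few-edges = begin-strict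
      #ᵛ (λ _ → true) xs                ≡⟨ trans (vsum-const 1 xs) (*-identityʳ _) ⟩
      length (edges G)                  ≤⟨ length-edges G ⟩
      N * N                             ≤⟨ *-mono-≤ N≤r^t (m≤m*n N (suc L)) ⟩
      suc a ^ t * (N * suc L)           ≡⟨ [x*y]*z≡[x*z]*y (suc a) (suc a ^ t′) (N * suc L) ⟩
      M′ * suc a ^ t′                   <⟨ m<n+m _ (m^n>0 (suc a) t′) ⟩
      suc a ^ t′ + M′ * suc a ^ t′      ∎
      where open ≤-Reasoning

    failures : ℕ
    failures = Σ⟨ (λ cs → # (survives cs) os) ⟩ tuples

    failures-bound : failures * 2 ^ N ≤ length os
    -- The common factor is the bound on the number of tuples times the numerator of ((r - 1)/r)^M,
    -- so no division occurs.
    failures-bound = *-cancelʳ-≤ _ _ (2 ^ (N * L) * a ^ M) {{m*n≢0 _ _ {{m^n≢0 2 (N * L)}} {{m^n≢0 a M}}}} (begin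
      failures * 2 ^ N * (2 ^ (N * L) * a ^ M)
        ≡⟨ swap failures (2 ^ N) (2 ^ (N * L)) (a ^ M) ⟩
      failures * (2 ^ (N * L) * 2 ^ N * a ^ M)
        ≤⟨ *-monoʳ-≤ failures decay ⟩
      failures * suc a ^ M
        ≡⟨ Σ-*ʳ (λ cs → # (survives cs) os) (suc a ^ M) tuples ⟩
      Σ⟨ (λ cs → # (survives cs) os * suc a ^ M) ⟩ tuples
        ≤⟨ Σ-mono tuples (λ {cs} _ → survivors-bound a (λ _ → true) (Vec.map mono cs) xs few-edges) ⟩
      Σ⟨ (λ _ → a ^ M * length (edges G) !) ⟩ tuples
        ≡⟨ Σ-const (a ^ M * length (edges G) !) tuples ⟩
      length tuples * (a ^ M * length (edges G) !)
        ≤⟨ *-monoˡ-≤ (a ^ M * length (edges G) !) (length-tuples q^t≤N) ⟩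
      2 ^ (N * L) * (a ^ M * length (edges G) !)
        ≡⟨ cong (λ d → 2 ^ (N * L) * (a ^ M * d)) (length-orderings xs) ⟨
      2 ^ (N * L) * (a ^ M * length os)
        ≡⟨ x*[y*z]≡z*[x*y] (2 ^ (N * L)) (a ^ M) (length os) ⟩
      length os * (2 ^ (N * L) * a ^ M) ∎)
      where
      open ≤-Reasoning
      swap : ∀ f x y z → f * x * (y * z) ≡ f * (y * x * z)
      swap = solve-∀

    success : Succeeds algorithm q t G
    success = fewFailures⇒succeeds algorithm q t G failures
      (unionBound (λ s → distinguishes? q t (χ G) (run algorithm s)) survives tuples os λ {s} s∈ →
        let s↭ = ↭-trans (orderings-↭ xs s∈) (↭-reflexive (toList∘fromList (edges G))) in
        Sum.map (subst (Distinguishes q t (χ G)) (sym (run-algorithm s)))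
                (λ { (cs , sv) → cs , ∈-words (∈-words ∈-allFin) cs , sv })
                (correct-or-survives G s (∈-resp-↭ s↭) (∈-resp-↭ (↭-sym s↭))))
      failures-bound

-- The space bound.

-- Three factors of order L arise: from the bits of an edge, from the length of a block and, as t <
-- L, from the number of blocks. Since 1 + a ≤ 2 a, rounding the root up costs at most a factor 2,
-- which turns 10 into 20.
space-bound : ∀ t a n L .{{_ : NonZero a}} .{{_ : NonZero n}} .{{_ : NonZero L}} →
  t < L → a ^ t ≤ n →
  let bits = suc (suc a * (n * suc L)) * suc (L + L) in
  (t * suc bits + bits) ^ t ≤ (20 * L ^ 3) ^ t * n ^ (t + 1)
space-bound t a n@(suc n′) L@(suc l) t<L a^t≤n = begin
  (t * suc bits + bits) ^ t                       ≤⟨ ^-monoˡ-≤ t linear ⟩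
  (10 * L ^ 3 * (suc a * n)) ^ t                  ≡⟨ *-^-distrib (10 * L ^ 3) (suc a * n) t ⟩
  (10 * L ^ 3) ^ t * (suc a * n) ^ t              ≡⟨ cong ((10 * L ^ 3) ^ t *_) (*-^-distrib (suc a) n t) ⟩
  (10 * L ^ 3) ^ t * (suc a ^ t * n ^ t)          ≤⟨ *-monoʳ-≤ ((10 * L ^ 3) ^ t) (*-monoˡ-≤ (n ^ t) root) ⟩
  (10 * L ^ 3) ^ t * (2 ^ t * n * n ^ t)          ≡⟨ cong ((10 * L ^ 3) ^ t *_) (*-assoc (2 ^ t) n (n ^ t)) ⟩
  (10 * L ^ 3) ^ t * (2 ^ t * n ^ suc t)          ≡⟨ *-assoc ((10 * L ^ 3) ^ t) (2 ^ t) (n ^ suc t) ⟨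
  (10 * L ^ 3) ^ t * 2 ^ t * n ^ suc t            ≡⟨ cong (_* n ^ suc t) (*-^-distrib (10 * L ^ 3) 2 t) ⟨
  (10 * L ^ 3 * 2) ^ t * n ^ suc t                ≡⟨ cong₂ (λ c e → c ^ t * n ^ e) (double (L ^ 3)) (sym (+-comm t 1)) ⟩
  (20 * L ^ 3) ^ t * n ^ (t + 1)                  ∎
  where
  open ≤-Reasoning
  bits = suc (suc a * (n * suc L)) * suc (L + L)

  double : ∀ x → 10 * x * 2 ≡ 20 * x
  double = solve-∀

  collect : ∀ t b → t * (1 + b) + b + 1 ≡ (1 + t) * (1 + b)
  collect = solve-∀

  -- The remainder is what is left after writing L = 1 + l and (1 + a) n = 1 + x.
  expand : ∀ a n l → let x = n + a * (1 + n) in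
    1 + (1 + (1 + a) * ((1 + n) * (2 + l))) * (1 + ((1 + l) + (1 + l)))
      + (11 * l + 8 * (l * l) + x * (4 + 13 * l + 8 * (l * l)))
    ≡ 10 * ((1 + a) * (1 + n)) * ((1 + l) * (1 + l))
  expand = solve-∀

  cube : ∀ x y → x * (10 * y * (x * x)) ≡ 10 * (x * (x * (x * 1))) * y
  cube = solve-∀

  linear : t * suc bits + bits ≤ 10 * L ^ 3 * (suc a * n)
  linear = begin
    t * suc bits + bits                    ≤⟨ m≤m+n _ 1 ⟩
    t * suc bits + bits + 1                ≡⟨ collect t bits ⟩
    suc t * suc bits                       ≤⟨ *-mono-≤ t<L (≤-trans (m≤m+n (suc bits) _) (≤-reflexive (expand a n′ l))) ⟩
    L * (10 * (suc a * n) * (L * L))       ≡⟨ cube L (suc a * n) ⟩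
    10 * L ^ 3 * (suc a * n)               ∎

  root : suc a ^ t ≤ 2 ^ t * n
  root = begin
    suc a ^ t        ≤⟨ ^-monoˡ-≤ t (+-mono-≤ (>-nonZero⁻¹ a) (m≤m+n a 0)) ⟩
    (2 * a) ^ t      ≡⟨ *-^-distrib 2 a t ⟩
    2 ^ t * a ^ t    ≤⟨ *-monoʳ-≤ (2 ^ t) a^t≤n ⟩
    2 ^ t * n        ∎

-- The rounded root and the choice of algorithm.

root-spec : ∀ t′ n → ∃[ r ] (n ≤ r ^ suc t′ × (∀ j → n ≤ j ^ suc t′ → r ≤ j))
root-spec t′ zero    = 0 , z≤n , λ _ _ → z≤n
root-spec t′ n@(suc _) = least (λ r → n ≤? r ^ suc t′) n (m≤m*n n (n ^ t′) {{m^n≢0 n t′}})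

root : ℕ → ℕ → ℕ
root t′ n = proj₁ (root-spec t′ n)

-- Exposes the predecessor `a` of the rounded-up root: n ≤ (1 + a)^t serves correctness, and a^t < n
-- serves the space bound.
IsRoot : ℕ → ℕ → ℕ → Set
IsRoot t n r = ∃[ a ] (NonZero a × r ≡ suc a × n ≤ suc a ^ t × a ^ t < n)

root-isRoot : ∀ t′ n → 1 < n → IsRoot (suc t′) n (root t′ n)
root-isRoot t′ n 1<n with root-spec t′ n
... | zero        , n≤0 , _   = contradiction (<-≤-trans 1<n n≤0) λ ()
... | suc zero    , n≤1 , _   =
  contradiction (<-≤-trans 1<n (≤-trans n≤1 (≤-reflexive (^-zeroˡ (suc t′))))) λ { (s≤s ()) }
... | suc (suc a) , n≤  , min = suc a , _ , refl , n≤ , ≰⇒> λ n≤a^t → 1+n≰n (min (suc a) n≤a^t)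

main-space : ∀ q t′ n′ r → IsRoot (suc t′) (suc n′) r → 2 ≤ q → q ^ suc t′ < suc n′ →
  space (Main.algorithm q t′ n′ r) ^ suc t′ ≤ (20 * ⌈log₂ suc n′ ⌉ ^ 3) ^ suc t′ * suc n′ ^ (suc t′ + 1)
main-space q t′ n′ _ (a , a≢0 , refl , _ , a^t<n) 2≤q q^t<n =
  space-bound (suc t′) a (suc n′) L {{a≢0}} {{_}} {{>-nonZero (≤-<-trans z≤n t<L)}} t<L (<⇒≤ a^t<n)
  where
  L = ⌈log₂ suc n′ ⌉
  t<L : suc t′ < L
  -- Otherwise n ≤ 2^L ≤ 2^t ≤ q^t, against q^t < n.
  t<L = ≰⇒> λ L≤t → <⇒≱ (≤-<-trans (^-monoˡ-≤ (suc t′) 2≤q) q^t<n)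
    (≤-trans (n≤2^⌈log₂n⌉ (suc n′)) (^-monoʳ-≤ 2 L≤t))

main-succeeds : ∀ q t′ n′ r → IsRoot (suc t′) (suc n′) r → q ^ suc t′ < suc n′ → ∀ G →
  Succeeds (Main.algorithm q t′ n′ r) q (suc t′) G
main-succeeds q t′ n′ _ (a , a≢0 , refl , n≤r^t , _) q^t<n G =
  success q t′ n′ a {{a≢0}} n≤r^t (<⇒≤ q^t<n) G

q^t<n⇒1<n : ∀ {q} t → 2 ≤ q → q ^ t < n → 1 < n
q^t<n⇒1<n t 2≤q q^t<n = ≤-<-trans (≤-trans (m^n>0 2 t) (^-monoˡ-≤ t 2≤q)) q^t<n

-- If q^t ≥ n, then χ(G) > q^t is impossible.
choose : ∀ q t′ n′ → Dec (q ^ suc t′ < suc n′) → StreamingAlgorithm (suc n′)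
choose q t′ n′ (yes _) = Main.algorithm q t′ n′ (root t′ (suc n′))
choose q t′ n′ (no _)  = alwaysSmall

choose-space : ∀ q t′ n′ d → 2 ≤ q →
  space (choose q t′ n′ d) ^ suc t′ ≤ (20 * ⌈log₂ suc n′ ⌉ ^ 3) ^ suc t′ * suc n′ ^ (suc t′ + 1)
choose-space q t′ n′ (no _)      2≤q = z≤n
choose-space q t′ n′ (yes q^t<n) 2≤q =
  main-space q t′ n′ _ (root-isRoot t′ (suc n′) (q^t<n⇒1<n (suc t′) 2≤q q^t<n)) 2≤q q^t<n

choose-succeeds : ∀ q t′ n′ d → 2 ≤ q → ∀ G → Succeeds (choose q t′ n′ d) q (suc t′) G
choose-succeeds q t′ n′ (no q^t≮n)  2≤q G = alwaysSmall-succeeds q (suc t′) G (≮⇒≥ q^t≮n)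
choose-succeeds q t′ n′ (yes q^t<n) 2≤q G =
  main-succeeds q t′ n′ _ (root-isRoot t′ (suc n′) (q^t<n⇒1<n (suc t′) 2≤q q^t<n)) q^t<n G

algorithm : (q t n : ℕ) → StreamingAlgorithm n
algorithm q zero     n        = alwaysSmall
algorithm q (suc t′) zero     = alwaysSmall
algorithm q (suc t′) (suc n′) = choose q t′ n′ (q ^ suc t′ <? suc n′)

algorithm-space : ∀ q t n → 2 ≤ q → 2 ≤ t →
  space (algorithm q t n) ^ t ≤ (20 * ⌈log₂ n ⌉ ^ 3) ^ t * n ^ (t + 1)
algorithm-space q (suc t′) zero     2≤q 2≤t = z≤n
algorithm-space q (suc t′) (suc n′) 2≤q 2≤t = choose-space q t′ n′ (q ^ suc t′ <? suc n′) 2≤q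

algorithm-succeeds : ∀ q t → 2 ≤ q → 2 ≤ t → ∀ n (G : Graph n) → Succeeds (algorithm q t n) q t G
algorithm-succeeds q (suc t′) 2≤q 2≤t zero     G = alwaysSmall-succeeds q (suc t′) G z≤n
algorithm-succeeds q (suc t′) 2≤q 2≤t (suc n′) G = choose-succeeds q t′ n′ (q ^ suc t′ <? suc n′) 2≤q G

opaque
  unfolding Succeeds

  algorithm-succeeds′ : ∀ q t → 2 ≤ q → 2 ≤ t → ∀ n (G : Graph n) →
    1ℚ - (2^- n) ≤ℚ successProbability (algorithm q t n) q t G
  algorithm-succeeds′ = algorithm-succeeds

theorem4 : Σ[ alg ∈ ((q t n : ℕ) → StreamingAlgorithm n) ]
    (IsÕ[n^1+1/t] (λ q t n → space (alg q t n)) ×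
    (∃[ f ] (IsΩ[n] f ×
    (∀ (q t : ℕ) → 2 ≤ q → 2 ≤ t → ∀ (n : ℕ) (G : Graph n) →
    1ℚ - (2^- f n) ≤ℚ successProbability (alg q t n) q t G))))
theorem4 =
  algorithm ,
  (20 , 3 , 0 , λ q t n 2≤q 2≤t _ → algorithm-space q t n 2≤q 2≤t) ,
  -- The exponent is n itself, as `decay` reserves a full factor 2^N.
  (λ n → n) , (1 , 0 , λ n _ → ≤-reflexive (sym (*-identityˡ n))) ,
  algorithm-succeeds′
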